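{- For every $p\in\omega^{*}$, the relation $\omega^{*}\rightarrow(\omega\cup\{p\})^{1}_{2}$ fails, where $\omega\cup\{p\}$ carries the subspace topology from $\beta(\omega)$.
   Context: $\omega$ is the countably infinite discrete space, $\beta(\omega)$ its Stone-Čech compactification, and $\omega^{*}=\beta(\omega)\setminus\omega$ with the subspace topology. For topological spaces $X,Y$, the relation $X\rightarrow(Y)^{1}_{2}$ means: whenever $X=P_0\cup P_1$, there are $i\in\{0,1\}$ and $Y'\subseteq P_i$ such that $Y'$ (with the subspace topology from $X$) is homeomorphic to $Y$. -}

module Defs where

open import Data.Bool using (Bool; true; false; not; _∧_; T)
open import Data.Bool.Properties using (T-∧)
open import Data.Fin using (Fin)
open import Data.Nat using (ℕ)
open import Data.Product using (Σ; ∃; _×_; _,_; proj₁; proj₂)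
open import Data.Sum using (_⊎_; inj₁; inj₂)
open import Data.Unit using (tt)
open import Function using (_∘_; id)
open import Function.Bundles using (Inverse; module Equivalence)
open import Level using (0ℓ) renaming (suc to lsuc)
open import Relation.Binary using (Setoid; _Respects_)
open import Relation.Binary.PropositionalEquality using (_≡_; refl; sym; trans; subst)
open import Relation.Nullary using (¬_)
open import Relation.Unary using (Pred; U; _∩_; ⋃; _∈_; _∪_; ∁; _⊆_; _≐_; _⊢_)
import Relation.Binary.Construct.On as On

-- Points form a setoid: a subspace is a Σ-type whose points are compared
-- by their first components only.  The empty union gives the openness of ∅.

record Space : Set₂ where
  field
    points : Setoid 0ℓ 0ℓ

  open Setoid points public using (Carrier; _≈_)

  field
    Open        : Pred (Pred Carrier 0ℓ) (lsuc 0ℓ)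
    Open-resp-≈ : ∀ {V} → Open V → V Respects _≈_
    Open-resp-≐ : ∀ {V W} → V ≐ W → Open V → Open W
    Open-U      : Open U
    Open-∩      : ∀ {V W} → Open V → Open W → Open (V ∩ W)
    Open-⋃      : ∀ (I : Set) (V : I → Pred Carrier 0ℓ) →
                  (∀ i → Open (V i)) → Open (⋃ I V)

open Space using (Carrier)

Subspace : (X : Space) → Pred (Carrier X) 0ℓ → Space
Subspace X S = record
  { points      = On.setoid {B = Σ (Carrier X) S} X.points proj₁
  ; Open        = λ V → ∃ λ W → X.Open W × V ≐ (proj₁ ⊢ W)
  ; Open-resp-≈ = λ (W , oW , V⊆ , ⊆V) x≈y x∈V →
                    ⊆V (X.Open-resp-≈ oW x≈y (V⊆ x∈V))
  ; Open-resp-≐ = λ (V⊆V′ , V′⊆V) (W , oW , V⊆ , ⊆V) →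
                    W , oW , (λ x → V⊆ (V′⊆V x)) , (λ x → V⊆V′ (⊆V x))
  ; Open-U      = U , X.Open-U , id , id
  ; Open-∩      = λ (W , oW , V⊆ , ⊆V) (W′ , oW′ , V′⊆ , ⊆V′) →
                    W ∩ W′ , X.Open-∩ oW oW′
                    , (λ (x , y) → V⊆ x , V′⊆ y)
                    , (λ (x , y) → ⊆V x , ⊆V′ y)
  ; Open-⋃      = λ I V o →
                    ⋃ I (λ i → proj₁ (o i))
                    , X.Open-⋃ I _ (λ i → proj₁ (proj₂ (o i)))
                    , (λ (i , x) → i , proj₁ (proj₂ (proj₂ (o i))) x)
                    , (λ (i , x) → i , proj₂ (proj₂ (proj₂ (o i))) x)
  }
  where module X = Space X

Continuous : (X Y : Space) → (Carrier X → Carrier Y) → Set₁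
Continuous X Y f = ∀ {V} → Space.Open Y V → Space.Open X (f ⊢ V)

record Homeomorphism (X Y : Space) : Set₁ where
  field
    inverse         : Inverse (Space.points X) (Space.points Y)
    to-continuous   : Continuous X Y (Inverse.to inverse)
    from-continuous : Continuous Y X (Inverse.from inverse)

-- The relation X → (Y)¹₂.  The two pieces need not be disjoint.

_⟶⟨_⟩¹₂ : Space → Space → Set₁
X ⟶⟨ Y ⟩¹₂ =
  (P : Fin 2 → Pred X.Carrier 0ℓ) → (∀ i → P i Respects X._≈_) →
  (∀ x → ∃ λ i → x ∈ P i) →
  ∃ λ i → ∃ λ (Y′ : Pred X.Carrier 0ℓ) →
    Y′ Respects X._≈_ × Y′ ⊆ P i × Homeomorphism (Subspace X Y′) Y
  where module X = Space X

-- β(ω) is the space of ultrafilters on ℕ.  Subsets of ℕ, and sets of such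
-- subsets, are Boolean-valued; under excluded middle these are all of them.

record Ultrafilter : Set where
  field
    mem    : (ℕ → Bool) → Bool
    whole  : T (mem (λ _ → true))
    proper : ¬ T (mem (λ _ → false))
    meet   : ∀ A B → T (mem A) → T (mem B) → T (mem (λ n → A n ∧ B n))
    upward : ∀ A B → (∀ n → T (A n) → T (B n)) → T (mem A) → T (mem B)
    ultra  : ∀ A → T (mem A) ⊎ T (mem (not ∘ A))

open Ultrafilter

-- The basic clopen set of ultrafilters containing A.

⟦_⟧ : (ℕ → Bool) → Pred Ultrafilter 0ℓ
⟦ A ⟧ u = T (mem u A)

βω : Space
βω = record
  { points = record
      { Carrier       = Ultrafilter
      ; _≈_           = λ u v → ∀ A → mem u A ≡ mem v A
      ; isEquivalence = record
          { refl  = λ _ → refl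
          ; sym   = λ e A → sym (e A)
          ; trans = λ e f A → trans (e A) (f A)
          }
      }
  ; Open        = λ V → ∃ λ (F : Pred (ℕ → Bool) 0ℓ) → V ≐ generated F
  ; Open-resp-≈ = λ (F , V⊆ , ⊆V) u≈v u∈V →
                    let (A , A∈F , A∈u) = V⊆ u∈V
                    in ⊆V (A , A∈F , subst T (u≈v A) A∈u)
  ; Open-resp-≐ = λ (V⊆W , W⊆V) (F , V⊆ , ⊆V) →
                    F , (λ x → V⊆ (W⊆V x)) , (λ x → V⊆W (⊆V x))
  ; Open-U      = U , (λ {u} _ → (λ _ → true) , tt , whole u) , (λ _ → tt)
  ; Open-∩      = λ (F , V⊆ , ⊆V) (G , W⊆ , ⊆W) →
                    (λ C → ∃ λ A → ∃ λ B →
                       A ∈ F × B ∈ G × C ≡ (λ n → A n ∧ B n))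
                    , (λ {u} (x , y) →
                         let (A , A∈F , A∈u) = V⊆ x
                             (B , B∈G , B∈u) = W⊆ y
                         in _ , (A , B , A∈F , B∈G , refl)
                              , meet u A B A∈u B∈u)
                    , λ { {u} (_ , (A , B , A∈F , B∈G , refl) , C∈u) →
                            ⊆V (A , A∈F , upward u _ A
                                 (λ n → proj₁ ∘ Equivalence.to T-∧) C∈u)
                          , ⊆W (B , B∈G , upward u _ B
                                 (λ n → proj₂ ∘ Equivalence.to (T-∧ {A n})) C∈u) }
  ; Open-⋃      = λ I V o →
                    ⋃ I (λ i → proj₁ (o i))
                    , (λ (i , x) → let (A , A∈F , A∈u) = proj₁ (proj₂ (o i)) x
                                   in A , (i , A∈F) , A∈u)
                    , (λ (A , (i , A∈F) , A∈u) →
                         i , proj₂ (proj₂ (o i)) (A , A∈F , A∈u))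
  }
  where
  generated : Pred (ℕ → Bool) 0ℓ → Pred Ultrafilter 0ℓ
  generated F u = ∃ λ A → A ∈ F × u ∈ ⟦ A ⟧

principal : ℕ → Ultrafilter
principal n = record
  { mem    = λ A → A n
  ; whole  = tt
  ; proper = λ ()
  ; meet   = λ A B a b → Equivalence.from T-∧ (a , b)
  ; upward = λ A B A⊆B → A⊆B n
  ; ultra  = λ A → T-or-not (A n)
  }
  where
  T-or-not : ∀ b → T b ⊎ T (not b)
  T-or-not true  = inj₁ tt
  T-or-not false = inj₂ tt

-- ω as a subset of β(ω).

ω : Pred Ultrafilter 0ℓ
ω u = ∃ λ n → Space._≈_ βω u (principal n)

ω* : Space
ω* = Subspace βω (∁ ω)

ω∪⟨_⟩ : Carrier ω* → Space
ω∪⟨ p , _ ⟩ = Subspace βω (ω ∪ λ u → Space._≈_ βω u p)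

{-# OPTIONS --safe #-}

-- A copy of ω ∪ {p} is a discrete sequence f with p-limit x.  Modulo p, the
-- sequence f is determined by x, so it suffices to two-colour the ultrafilters
-- such that p-almost all f n get the colour opposite to x, whenever x = p-lim f.
-- Take a maximal partial colouring M that colours p-almost all f n oppositely
-- for every coloured x = p-lim f.  If x is uncoloured then it is a p-limit of
-- points p-almost all of which are uncoloured, since otherwise the colour of x
-- would be free or forced, and M could be extended to x.  Iterating, x is the
-- root of a tree of uncoloured points in which every node is the p-limit of its
-- children; as p is nonprincipal, the pieces separating siblings never contain
-- the parent, so the nodes are distinct and the parity of the depth extends M.

module Submission where

open import Defs
open import Axiom.ExcludedMiddle using (ExcludedMiddle)
open import Axiom.Extensionality.Propositional using (Extensionality)
open import Relation.Nullary using (¬_)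

open import Data.Bool using (Bool; true; false; not; _∧_; T)
open import Data.Bool.Properties using (T-∧; T-irrelevant; not-¬)
open import Data.Empty using (⊥; ⊥-elim)
open import Data.Fin using (Fin; zero; suc)
open import Data.Nat using (ℕ; zero; suc; _<_; _≡ᵇ_)
open import Data.Nat.Induction using (<-wellFounded)
open import Data.Nat.Properties
  using (<-cmp; ≡ᵇ⇒≡; ≡⇒≡ᵇ; <-irrefl; m<1+n⇒m<n∨m≡n; m<n⇒m<1+n; n<1+n)
open import Data.Product using (∃; _×_; _,_; proj₁; proj₂)
open import Data.Sum using (_⊎_; inj₁; inj₂; [_,_]′)
open import Data.Unit using (tt)
open import Function using (_∘_; id; _$_)
open import Function.Bundles using (Inverse; module Equivalence)
open import Induction.WellFounded using (module FixPoint; module All)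
open import Level using (Level; 0ℓ)
open import Relation.Binary using (Tri; tri<; tri≈; tri>)
open import Relation.Binary.PropositionalEquality
  using (_≡_; _≢_; refl; sym; trans; cong; subst)
open import Relation.Nullary using (yes; no)
open import Relation.Nullary.Decidable using (⌊_⌋; True; toWitness; fromWitness)
open import Relation.Unary using (Pred; U; _∩_; _∪_; ∁; _∈_; _⊢_)

open Ultrafilter

module Classical (em : ∀ {ℓ} → ExcludedMiddle ℓ)
                 (ext : ∀ {a b} → Extensionality a b) where

  private variable
    ℓ : Level
    P Q R : Pred ℕ 0ℓ
    p u v x : Ultrafilter
    f g : ℕ → Ultrafilter

  -- Consequences of excluded middle

  ⟪_⟫ : Set ℓ → Bool
  ⟪ P ⟫ = ⌊ em {P = P} ⌋

  dne : {A : Set ℓ} → ¬ ¬ A → A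
  dne {A = A} ¬¬a with em {P = A}
  ... | yes a = a
  ... | no ¬a = ⊥-elim (¬¬a ¬a)

  -- The element is picked before a witness is known, so it can be a total function of the
  -- parameters of `B`.
  choose : {A : Set} → A → (B : A → Set ℓ) → ∃ λ a → ∃ B → B a
  choose default B with em {P = ∃ B}
  ... | yes (a , b) = a , λ _ → b
  ... | no ∄        = default , λ ∃b → ⊥-elim (∄ ∃b)

  T-injective : ∀ {b c} → (T b → T c) → (T c → T b) → b ≡ c
  T-injective {false} {false} _ _ = refl
  T-injective {false} {true}  _ g = ⊥-elim (g tt)
  T-injective {true}  {false} f _ = ⊥-elim (f tt)
  T-injective {true}  {true}  _ _ = refl

  T-∧-not : ∀ b → ¬ T (b ∧ not b)
  T-∧-not true  ()
  T-∧-not false ()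

  -- Zorn's lemma for families of subsets

  module Zorn {A : Set} where

    Subset : Set
    Subset = A → Bool

    _⊑_ : Subset → Subset → Set
    M ⊑ N = ∀ a → T (M a) → T (N a)

    ⊑-antisym : ∀ {M N} → M ⊑ N → N ⊑ M → M ≡ N
    ⊑-antisym M⊑N N⊑M = ext λ a → T-injective (M⊑N a) (N⊑M a)

    ⊔ : {I : Set} → (I → Subset) → Subset
    ⊔ F a = ⟪ (∃ λ i → T (F i a)) ⟫

    ⊑-⊔ : {I : Set} (F : I → Subset) → ∀ i → F i ⊑ ⊔ F
    ⊑-⊔ F i a a∈ = fromWitness (i , a∈)

    ⊔-⊑ : {I : Set} (F : I → Subset) {N : Subset} → (∀ i → F i ⊑ N) → ⊔ F ⊑ N
    ⊔-⊑ F F⊑N a a∈ with i , a∈Fi ← toWitness a∈ = F⊑N i a a∈Fi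

    module _ (Good : Pred Subset ℓ)
             (Good-⊔ : {I : Set} (F : I → Subset) → (∀ i → Good (F i)) →
                       (∀ i j → F i ⊑ F j ⊎ F j ⊑ F i) → Good (⊔ F)) where

      ProperExtension : Subset → Set ℓ
      ProperExtension M = ∃ λ N → Good N × M ⊑ N × ¬ N ⊑ M

      extend : Subset → Subset
      extend M with em {P = ProperExtension M}
      ... | yes (N , _) = N
      ... | no _        = M

      ⊑-extend : ∀ M → M ⊑ extend M
      ⊑-extend M with em {P = ProperExtension M}
      ... | yes (_ , _ , M⊑N , _) = M⊑N
      ... | no _                  = λ _ → id

      Good-extend : ∀ {M} → Good M → Good (extend M)
      Good-extend {M} good with em {P = ProperExtension M}
      ... | yes (_ , goodN , _) = goodN
      ... | no _                = good

      extend-fixed : ∀ {M} → extend M ⊑ M → ¬ ProperExtension M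
      extend-fixed {M} fixed with em {P = ProperExtension M}
      ... | yes (_ , _ , _ , N⋢M) = λ _ → N⋢M fixed
      ... | no maximal            = maximal

      -- Transfinite iterates of `extend`, without ordinals; the empty `sup` is the start.
      data Stage : Set₁ where
        next : Stage → Stage
        sup  : {I : Set} → (I → Stage) → Stage

      val : Stage → Subset
      val (next s) = extend (val s)
      val (sup F)  = ⊔ (val ∘ F)

      -- As in the Bourbaki-Witt argument. The stronger first alternative carries the induction past
      -- `next`: if `val s` and `val t` contain each other, their extensions coincide.
      compare : ∀ s t → extend (val s) ⊑ val t ⊎ val t ⊑ val s
      compare s (next t) with compare s t
      ... | inj₁ es⊑t = inj₁ (λ a → ⊑-extend (val t) a ∘ es⊑t a)
      ... | inj₂ t⊑s with compare t s
      ...   | inj₁ et⊑s = inj₂ et⊑s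
      ...   | inj₂ s⊑t  = inj₁ (λ a → subst (λ M → T (extend M a)) (⊑-antisym s⊑t t⊑s))
      compare s (sup F) with em {P = ∃ λ i → extend (val s) ⊑ val (F i)}
      ... | yes (i , es⊑Fi) = inj₁ (λ a → ⊑-⊔ (val ∘ F) i a ∘ es⊑Fi a)
      ... | no ∄            = inj₂ (⊔-⊑ (val ∘ F) λ i →
        [ (λ es⊑Fi → ⊥-elim (∄ (i , es⊑Fi))) , id ]′ (compare s (F i)))

      Good-val : ∀ s → Good (val s)
      Good-val (next s) = Good-extend (Good-val s)
      Good-val (sup F)  = Good-⊔ (val ∘ F) (λ i → Good-val (F i)) λ i j →
        [ (λ ei⊑j → inj₁ (λ a → ei⊑j a ∘ ⊑-extend (val (F i)) a)) , inj₂ ]′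
          (compare (F i) (F j))

      -- Indexed by the values of stages instead of the stages, which form a
      -- large type.
      top : Stage
      top = sup {I = ∃ λ M → True (em {P = ∃ λ s → val s ≡ M})}
                (λ (_ , w) → proj₁ (toWitness w))

      -- The value of `next top` is among those united in `top`, so `extend` adds nothing to
      -- `val top`.
      maximal-good : ∃ λ M → Good M × ¬ ProperExtension M
      maximal-good = val top , Good-val top , extend-fixed next⊑top
        where
        next⊑top : val (next top) ⊑ val top
        next⊑top a a∈ =
          let w = fromWitness (next top , refl)
          in fromWitness ((_ , w) , subst (λ M → T (M a)) (sym (proj₂ (toWitness w))) a∈)

  -- Ultrafilters

  infix 4 _∋_

  -- A record rather than a synonym, so that u and P can be inferred.
  record _∋_ (u : Ultrafilter) (P : Pred ℕ 0ℓ) : Set where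
    constructor holds
    field holds⁻¹ : T (mem u (λ n → ⟪ P n ⟫))

  ∋-map : (∀ {n} → P n → Q n) → u ∋ P → u ∋ Q
  ∋-map {u = u} P⊆Q (holds x) = holds (upward u _ _ (λ n → fromWitness ∘ P⊆Q ∘ toWitness) x)

  ∋-∩ : u ∋ P → u ∋ Q → u ∋ P ∩ Q
  ∋-∩ {u = u} {P = P} (holds x) (holds y) = holds (upward u _ _
    (λ n PQ → let (p , q) = Equivalence.to (T-∧ {⟪ P n ⟫}) PQ
              in fromWitness (toWitness p , toWitness q))
    (meet u _ _ x y))

  ∋-zip : (∀ {n} → P n → Q n → R n) → u ∋ P → u ∋ Q → u ∋ R
  ∋-zip h u∋P u∋Q = ∋-map (λ (x , y) → h x y) (∋-∩ u∋P u∋Q)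

  ∋-inhabited : u ∋ P → ∃ P
  ∋-inhabited {u = u} (holds x) = dne λ ∄ →
    proper u (upward u _ _ (λ n Pn → ∄ (n , toWitness Pn)) x)

  ∋-always : (∀ n → P n) → u ∋ P
  ∋-always {u = u} h = holds (upward u _ _ (λ n _ → fromWitness (h n)) (whole u))

  ∋-∁ : ∀ P → ¬ u ∋ P → u ∋ ∁ P
  ∋-∁ {u = u} P ¬u∋P with ultra u (λ n → ⟪ P n ⟫)
  ... | inj₁ x = ⊥-elim (¬u∋P (holds x))
  ... | inj₂ x = holds (upward u _ _ (λ n → fromWitness ∘ not-true n) x)
    where
    not-true : ∀ n → T (not ⟪ P n ⟫) → ¬ P n
    not-true n with em {P = P n}
    ... | yes _ = λ ()
    ... | no ¬p = λ _ → ¬p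

  ∋-⊎ : u ∋ P ∪ Q → u ∋ P ⊎ u ∋ Q
  ∋-⊎ {u = u} {P = P} u∋P∪Q with em {P = u ∋ P}
  ... | yes u∋P = inj₁ u∋P
  ... | no ¬u∋P = inj₂ (∋-zip (λ { (inj₁ x) ¬x → ⊥-elim (¬x x) ; (inj₂ y) _ → y })
                               u∋P∪Q (∋-∁ P ¬u∋P))

  ∋⁺ : ∀ A → u ∈ ⟦ A ⟧ → u ∋ (T ∘ A)
  ∋⁺ {u} A x = holds (upward u _ _ (λ _ → fromWitness) x)

  ∋⁻ : ∀ A → u ∋ (T ∘ A) → u ∈ ⟦ A ⟧
  ∋⁻ {u} A (holds x) = upward u _ _ (λ _ → toWitness) x

  ∋-∁-disjoint : u ∋ P → ¬ u ∋ ∁ P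
  ∋-∁-disjoint u∋P u∋∁P with _ , Pn , ¬Pn ← ∋-inhabited (∋-∩ u∋P u∋∁P) = ¬Pn Pn

  ∋-∀< : (A : ℕ → Pred ℕ 0ℓ) → ∀ n → (∀ {m} → m < n → u ∋ A m) →
         u ∋ (λ i → ∀ m → m < n → A m i)
  ∋-∀< A zero    _ = ∋-always (λ _ _ ())
  ∋-∀< A (suc n) h = ∋-zip extend-bound (∋-∀< A n (h ∘ m<n⇒m<1+n)) (h (n<1+n n))
    where
    extend-bound : ∀ {i} → (∀ m → m < n → A m i) → A n i → ∀ m → m < suc n → A m i
    extend-bound below at m m<1+n with m<1+n⇒m<n∨m≡n m<1+n
    ... | inj₁ m<n  = below m m<n
    ... | inj₂ refl = at

  -- Otherwise the complements of the finitely many fibres below `n` would have their intersection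
  -- in `u`.
  ∋-<⇒∋-≡ : (b : ℕ → ℕ) → ∀ n → u ∋ (λ i → b i < n) → ∃ λ m → m < n × u ∋ (λ i → b i ≡ m)
  ∋-<⇒∋-≡ b n u∋b<n = dne λ ∄ → ∋-∁-disjoint u∋b<n $
    ∋-map (λ b≢ b<n → b≢ _ b<n refl) $
    ∋-∀< (λ m i → b i ≢ m) n (λ {m} m<n → ∋-∁ _ (λ b≡m → ∄ (m , m<n , b≡m)))

  -- The other fields have at most one value, `ultra` because `A` and its complement are never both
  -- members. So `_≈_` yields `_≡_`, which every colouring respects.
  mem-injective : mem u ≡ mem v → u ≡ v
  mem-injective {u} {record { mem = m ; whole = w ; proper = p ; meet = i ; upward = s ; ultra = d }} refl =
    go (T-irrelevant _ _)
       (ext λ x → ⊥-elim (p x))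
       (ext λ _ → ext λ _ → ext λ _ → ext λ _ → T-irrelevant _ _)
       (ext λ _ → ext λ _ → ext λ _ → ext λ _ → T-irrelevant _ _)
       (ext λ A → ⊎-irrelevant (disjoint A) _ _)
    where
    go : ∀ {w′ p′ i′ s′ d′} → w′ ≡ w → p′ ≡ p → i′ ≡ i → s′ ≡ s → d′ ≡ d →
         record { mem = m ; whole = w′ ; proper = p′ ; meet = i′ ; upward = s′ ; ultra = d′ }
         ≡ record { mem = m ; whole = w ; proper = p ; meet = i ; upward = s ; ultra = d }
    go refl refl refl refl refl = refl

    disjoint : ∀ A → T (m A) → ¬ T (m (not ∘ A))
    disjoint A A∈ ¬A∈ = p (s _ _ (λ n → T-∧-not (A n)) (i A _ A∈ ¬A∈))

    ⊎-irrelevant : ∀ {b c} → (T b → ¬ T c) → (x y : T b ⊎ T c) → x ≡ y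
    ⊎-irrelevant ¬bc (inj₁ x) (inj₁ y) = cong inj₁ (T-irrelevant x y)
    ⊎-irrelevant ¬bc (inj₁ x) (inj₂ y) = ⊥-elim (¬bc x y)
    ⊎-irrelevant ¬bc (inj₂ x) (inj₁ y) = ⊥-elim (¬bc y x)
    ⊎-irrelevant ¬bc (inj₂ x) (inj₂ y) = cong inj₂ (T-irrelevant x y)

  -- Ultrafilters are maximal filters: the complement of a set outside `u` lies in `u`, hence in
  -- `v`.
  ⊆⇒≡ : (∀ A → u ∈ ⟦ A ⟧ → v ∈ ⟦ A ⟧) → u ≡ v
  ⊆⇒≡ {u} {v} u⊆v = mem-injective (ext λ A → T-injective (u⊆v A) (v⊆u A))
    where
    v⊆u : ∀ A → v ∈ ⟦ A ⟧ → u ∈ ⟦ A ⟧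
    v⊆u A A∈v with ultra u A
    ... | inj₁ A∈u = A∈u
    ... | inj₂ A∉u = ⊥-elim (proper v (upward v _ _ (λ n → T-∧-not (A n))
                                                    (meet v A _ A∈v (u⊆v _ A∉u))))

  -- Discrete sequences and their limits along p

  -- Disjoint sets, one in each `f n`, are encoded as the fibres of a single function.
  _SeparatedBy_ : (ℕ → Ultrafilter) → (ℕ → ℕ) → Set
  f SeparatedBy a = ∀ n → f n ∋ (λ i → a i ≡ n)

  -- That is, n ↦ f n and p ↦ x define an embedding of ω ∪ {p}.
  record _⟶[_]_ (f : ℕ → Ultrafilter) (p x : Ultrafilter) : Set₁ where
    field
      label     : ℕ → ℕ
      separated : f SeparatedBy label
      limit     : ∀ P → x ∋ P → p ∋ (λ n → f n ∋ P)

    ∋-limit : p ∋ (λ n → f n ∋ P) → x ∋ P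
    ∋-limit {P = P} p∋ = dne λ ¬x∋P → ∋-∁-disjoint p∋ $
      ∋-map (λ ∋∁P ∋P → ∋-∁-disjoint ∋P ∋∁P) (limit (∁ P) (∋-∁ P ¬x∋P))

    -- Each `f n` is concentrated on the fibre over n, so `label` carries the limit `x` to `p`.
    ∋-label : p ∋ Q → x ∋ (Q ∘ label)
    ∋-label {Q = Q} p∋Q = ∋-limit $
      ∋-map (λ {n} Qn → ∋-map (λ a≡n → subst Q (sym a≡n) Qn) (separated n)) p∋Q

  open _⟶[_]_

  -- Label i by the first `B n` that contains it. As `f n` contains no earlier `B m`, removing those
  -- from `B n` leaves a set in `f n`.
  separate : (B : ℕ → Pred ℕ 0ℓ) → (∀ n → f n ∋ B n) →
             (∀ {m n} → f m ∋ B n → m ≡ n) → ∃ λ a → f SeparatedBy a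
  separate {f = f} B f∋B disjoint = (λ i → proj₁ (least i)) , λ n →
    ∋-zip (λ Bn ¬B → minimum-unique (proj₂ (least _) (_ , Bn , ¬B)) (Bn , ¬B)) (f∋B n) $
    ∋-∀< (λ m i → ¬ B m i) n λ {m} m<n →
      ∋-∁ _ (λ fn∋Bm → <-irrefl (sym (disjoint fn∋Bm)) m<n)
    where
    Least : ℕ → ℕ → Set
    Least i n = B n i × (∀ m → m < n → ¬ B m i)

    -- An i outside every `B n` gets label 0, which only enlarges that fibre.
    least : ∀ i → ∃ λ n → ∃ (Least i) → Least i n
    least i = choose 0 (Least i)

    minimum-unique : ∀ {i m n} → Least i m → Least i n → m ≡ n
    minimum-unique {m = m} {n} (Bm , ¬B<m) (Bn , ¬B<n) with <-cmp m n
    ... | tri< m<n _ _ = ⊥-elim (¬B<n _ m<n Bm)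
    ... | tri≈ _ m≡n _ = m≡n
    ... | tri> _ _ n<m = ⊥-elim (¬B<m _ n<m Bn)

  -- Linking each n to one chosen smaller m gives a forest, two-coloured by well-founded recursion.
  alternating : (R : ℕ → ℕ → Set) → ∃ λ (c : ℕ → Bool) →
                ∀ n → (∃ λ m → m < n × R n m) → ∃ λ m → R n m × c n ≡ not (c m)
  alternating R = colour , colour-alternates
    where
    Earlier : ℕ → Set
    Earlier n = ∃ λ m → m < n × R n m

    step : ∀ n → (∀ {m} → m < n → Bool) → Bool
    step n rec with em {P = Earlier n}
    ... | yes (_ , m<n , _) = not (rec m<n)
    ... | no _              = true

    step-ext : ∀ n {rec rec′ : ∀ {m} → m < n → Bool} →
               (∀ {m} (m<n : m < n) → rec m<n ≡ rec′ m<n) → step n rec ≡ step n rec′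
    step-ext n eq with em {P = Earlier n}
    ... | yes (_ , m<n , _) = cong not (eq m<n)
    ... | no _              = refl

    open FixPoint <-wellFounded (λ _ → Bool) step step-ext

    colour : ℕ → Bool
    colour = wfRec (λ _ → Bool) step
      where open All <-wellFounded 0ℓ

    step-alternates : ∀ n → Earlier n → ∃ λ m → R n m × step n (λ {m} _ → colour m) ≡ not (colour m)
    step-alternates n earlier with em {P = Earlier n}
    ... | yes (m , _ , r) = m , r , refl
    ... | no ∄            = ⊥-elim (∄ earlier)

    colour-alternates : ∀ n → Earlier n → ∃ λ m → R n m × colour n ≡ not (colour m)
    colour-alternates n earlier with m , r , eq ← step-alternates n earlier =
      m , r , trans unfold-wfRec eq

  -- Otherwise p-many f n lie in the m-th piece of the separation of g for some
  -- m = σ n < n.  Two-colour ℕ so that n and σ n get different colours; one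
  -- colour class belongs to p, yet both n and σ n would have to lie in it.
  label-≮ : (F : f ⟶[ p ] x) (G : g ⟶[ p ] x) → ¬ x ∋ (λ i → label G i < label F i)
  label-≮ {f = f} {p = p} F G x∋b<a with c , alt ← alternating (λ n m → f n ∋ (λ i → label G i ≡ m)) =
    [ monochromatic , monochromatic ]′ (∋-⊎ (∋-always (λ n → true-or-false (c n))))
    where
    true-or-false : ∀ b → b ≡ true ⊎ b ≡ false
    true-or-false true  = inj₁ refl
    true-or-false false = inj₂ refl

    earlier : p ∋ (λ n → ∃ λ m → m < n × f n ∋ (λ i → label G i ≡ m))
    earlier = ∋-map (λ {n} fn∋b<a →
      ∋-<⇒∋-≡ (label G) n (∋-zip (λ b<a a≡n → subst (_ <_) a≡n b<a) fn∋b<a (separated F n)))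
      (limit F _ x∋b<a)

    monochromatic : ∀ {e} → p ∋ (λ n → c n ≡ e) → ⊥
    monochromatic p∋c≡e
      -- By `∋-label`, `x` contains the i for which `label G i` has colour `e`, hence so do p-almost
      -- all `f n`. Such an i with label m shows that m has colour `e` as well.
      with n , (cn≡e , fn∋) , early ←
        ∋-inhabited (∋-∩ (∋-∩ p∋c≡e (limit F _ (∋-label G p∋c≡e))) earlier)
      with m , fn∋b≡m , cn≡¬cm ← alt n early
      with i , cb≡e , refl ← ∋-inhabited (∋-∩ fn∋ fn∋b≡m) =
      not-¬ (trans cn≡e (sym cb≡e)) cn≡¬cm

  -- By `label-≮` the two labels agree x-almost everywhere. If `f n` and `g n` differed for p-almost
  -- all n, sets telling them apart could be glued along the common pieces into one set that `x`
  -- contains as limit of `f` but not as limit of `g`.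
  limit-unique : f ⟶[ p ] x → g ⟶[ p ] x → p ∋ (λ n → f n ≡ g n)
  limit-unique {f = f} {p = p} {x = x} {g = g} F G =
    [ ⊥-elim ∘ label-≮ F G , [ ⊥-elim ∘ label-≮ G F , equal ]′ ∘ ∋-⊎ ]′
      (∋-⊎ (∋-always λ i → trichotomy (<-cmp (label G i) (label F i))))
    where
    trichotomy : ∀ {m n} → Tri (m < n) (m ≡ n) (n < m) → m < n ⊎ n < m ⊎ m ≡ n
    trichotomy (tri< m<n _ _) = inj₁ m<n
    trichotomy (tri≈ _ m≡n _) = inj₂ (inj₂ m≡n)
    trichotomy (tri> _ _ n<m) = inj₂ (inj₁ n<m)

    Distinguishes : ℕ → (ℕ → Bool) → Set
    Distinguishes n A = f n ∈ ⟦ A ⟧ × ¬ g n ∈ ⟦ A ⟧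

    C : ℕ → ℕ → Bool
    C n = proj₁ (choose (λ _ → true) (Distinguishes n))

    C-distinguishes : ∀ n → f n ≢ g n → Distinguishes n (C n)
    C-distinguishes n fn≢gn = proj₂ (choose _ (Distinguishes n)) $ dne λ ∄ →
      fn≢gn (⊆⇒≡ λ A fn∋A → dne λ gn∌A → ∄ (A , fn∋A , gn∌A))

    glued : ℕ → Set
    glued i = T (C (label G i) i)

    f∋glued : ∀ n → f n ≢ g n → f n ∋ (λ i → label G i ≡ label F i) → f n ∋ glued
    f∋glued n fn≢gn fn∋b≡a = ∋-zip
      (λ (b≡a , a≡n) Ci → subst (λ m → T (C m _)) (sym (trans b≡a a≡n)) Ci)
      (∋-∩ fn∋b≡a (separated F n))
      (∋⁺ (C n) (proj₁ (C-distinguishes n fn≢gn)))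

    g∌glued : ∀ n → f n ≢ g n → ¬ g n ∋ glued
    g∌glued n fn≢gn gn∋glued = proj₂ (C-distinguishes n fn≢gn) $ ∋⁻ (C n) $
      ∋-zip (λ { refl Ci → Ci }) (separated G n) gn∋glued

    equal : x ∋ (λ i → label G i ≡ label F i) → p ∋ (λ n → f n ≡ g n)
    equal x∋b≡a = dne λ ¬p∋≡ →
      let p∋≢ = ∋-∁ _ ¬p∋≡
          x∋glued = ∋-limit F (∋-zip (f∋glued _) p∋≢ (limit F _ x∋b≡a))
          _ , distinct , common = ∋-inhabited (∋-∩ p∋≢ (limit G glued x∋glued))
      in g∌glued _ distinct common

  -- Partial colourings

  module Colouring (p : Ultrafilter) (free : ∀ n → ¬ p ∋ (_≡ n)) where

    open Zorn {Ultrafilter × Bool}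

    -- A partial colouring is given by its graph, so that `⊑` means extension.
    record Good (M : Subset) : Set₁ where
      field
        functional : ∀ {x b c} → T (M (x , b)) → T (M (x , c)) → b ≡ c
        alternates : ∀ {f x b} → T (M (x , b)) → f ⟶[ p ] x → p ∋ (λ n → T (M (f n , not b)))

    open Good

    Good-⊔ : {I : Set} (F : I → Subset) → (∀ i → Good (F i)) →
             (∀ i j → F i ⊑ F j ⊎ F j ⊑ F i) → Good (⊔ F)
    functional (Good-⊔ F good chain) x∈ x∈′
      with i , x∈i ← toWitness x∈ | j , x∈j ← toWitness x∈′ | chain i j
    ... | inj₁ i⊑j = functional (good j) (i⊑j _ x∈i) x∈j
    ... | inj₂ j⊑i = functional (good i) x∈i (j⊑i _ x∈j)
    alternates (Good-⊔ F good chain) x∈ f⟶x with i , x∈i ← toWitness x∈ =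
      ∋-map (⊑-⊔ F i _) (alternates (good i) x∈i f⟶x)

    module Maximal {M : Subset} (good : Good M) (maximal : ¬ ProperExtension Good Good-⊔ M) where

      Uncoloured : Ultrafilter → Set
      Uncoloured x = ∀ b → ¬ T (M (x , b))

      -- Otherwise the union of `M` and `N` would be a good proper extension of `M`.
      no-extension : (N : Ultrafilter → Bool → Set) →
        (∀ {x b} → N x b → Uncoloured x) →
        (∀ {x b c} → N x b → N x c → b ≡ c) →
        (∀ {f x b} → N x b → f ⟶[ p ] x → p ∋ (λ n → T (M (f n , not b)) ⊎ N (f n) (not b))) →
        ∀ x b → ¬ N x b
      no-extension N off N-functional N-alternates x b Nxb =
        maximal (M∪N , good∪ , (λ _ → fromWitness ∘ inj₁) ,
                 λ M∪N⊑M → off Nxb b (M∪N⊑M (x , b) (fromWitness (inj₂ Nxb))))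
        where
        M∪N : Subset
        M∪N (x , b) = ⟪ (T (M (x , b)) ⊎ N x b) ⟫

        good∪ : Good M∪N
        functional good∪ {b = b} {c} x∈ x∈′ with toWitness x∈ | toWitness x∈′
        ... | inj₁ Mb | inj₁ Mc = functional good Mb Mc
        ... | inj₁ Mb | inj₂ Nc = ⊥-elim (off Nc b Mb)
        ... | inj₂ Nb | inj₁ Mc = ⊥-elim (off Nb c Mc)
        ... | inj₂ Nb | inj₂ Nc = N-functional Nb Nc
        alternates good∪ x∈ f⟶x with toWitness x∈
        ... | inj₁ Mb = ∋-map (fromWitness ∘ inj₁) (alternates good Mb f⟶x)
        ... | inj₂ Nb = ∋-map fromWitness (N-alternates Nb f⟶x)

      -- Otherwise `x` could be given the colour `b`.
      unforced : ∀ {x} → Uncoloured x → ∀ b →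
                 ¬ (∀ {f} → f ⟶[ p ] x → p ∋ (λ n → T (M (f n , not b))))
      unforced {x} x∉ b forced = no-extension (λ y c → y ≡ x × c ≡ b)
        (λ { (refl , _) → x∉ })
        (λ { (_ , refl) (_ , refl) → refl })
        (λ { (refl , refl) f⟶x → ∋-map inj₁ (forced f⟶x) })
        x b (refl , refl)

      -- One sequence misses `false` and another misses `true`, p-almost everywhere; by
      -- `limit-unique` they agree there, so a single one misses both.
      uncoloured-limit : ∀ x → Uncoloured x →
        ∃ λ f → ∃ λ (_ : f ⟶[ p ] x) → p ∋ (Uncoloured ∘ f)
      uncoloured-limit x x∉ with unforced-sequence true | unforced-sequence false
        where
        unforced-sequence : ∀ b → ∃ λ f → ∃ λ (_ : f ⟶[ p ] x) → ¬ p ∋ (λ n → T (M (f n , not b)))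
        unforced-sequence b = dne λ ∄ → unforced x∉ b λ {f} f⟶x →
          dne λ ¬p∋ → ∄ (f , f⟶x , ¬p∋)
      ... | f , f⟶x , ¬false | g , g⟶x , ¬true = f , f⟶x ,
        ∋-zip (λ (f≡g , g∉true) f∉false → λ
                 { true  → g∉true ∘ subst (λ y → T (M (y , true))) f≡g
                 ; false → f∉false })
              (∋-∩ (limit-unique f⟶x g⟶x) (∋-∁ _ ¬true)) (∋-∁ _ ¬false)

      -- Makes `seq x o` depend on `x` only.
      Uncoloured-irrelevant : ∀ {x} (o o′ : Uncoloured x) → o ≡ o′
      Uncoloured-irrelevant o o′ = ext λ b → ext λ x∈ → ⊥-elim (o b x∈)

      seq : ∀ x → Uncoloured x → ℕ → Ultrafilter
      seq x o = proj₁ (uncoloured-limit x o)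

      seq⟶ : ∀ x o → seq x o ⟶[ p ] x
      seq⟶ x o = proj₁ (proj₂ (uncoloured-limit x o))

      seq-uncoloured : ∀ x o → p ∋ (Uncoloured ∘ seq x o)
      seq-uncoloured x o = proj₂ (proj₂ (uncoloured-limit x o))

      piece : ∀ x → Uncoloured x → ℕ → Pred ℕ 0ℓ
      piece x o n i = label (seq⟶ x o) i ≡ n

      -- The tree of uncoloured points below x along the chosen sequences, where
      -- each branch is confined to smaller and smaller pieces, starting from A.
      -- The Boolean is the parity of the depth of u.
      data Tree (A : Pred ℕ 0ℓ) (x : Ultrafilter) : Ultrafilter → Bool → Set₁ where
        root   : Uncoloured x → Tree A x x false
        branch : ∀ {u b} o n → seq x o n ∋ A →
                 Tree (A ∩ piece x o n) (seq x o n) u b → Tree A x u (not b)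

      Tree-uncoloured : ∀ {A x u b} → Tree A x u b → Uncoloured u
      Tree-uncoloured (root o)         = o
      Tree-uncoloured (branch _ _ _ t) = Tree-uncoloured t

      Tree-∋ : ∀ {A x u b} → x ∋ A → Tree A x u b → u ∋ A
      Tree-∋ x∋A (root _)           = x∋A
      Tree-∋ x∋A (branch o n n∋A t) = ∋-map proj₁ (Tree-∋ (∋-∩ n∋A (separated (seq⟶ _ o) n)) t)

      branch-∋ : ∀ {A x u b} o n → seq x o n ∋ A →
                 Tree (A ∩ piece x o n) (seq x o n) u b → u ∋ piece x o n
      branch-∋ o n n∋A t = ∋-map proj₂ (Tree-∋ (∋-∩ n∋A (separated (seq⟶ _ o) n)) t)

      -- Otherwise p-almost all terms of the sequence would lie in the piece of index n, making `p`
      -- principal.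
      ∌-piece : ∀ x o n → ¬ x ∋ piece x o n
      ∌-piece x o n x∋n = free n $
        ∋-map (λ {m} m∋n → let _ , eq , eq′ = ∋-inhabited (∋-∩ (separated (seq⟶ x o) m) m∋n)
                           in trans (sym eq) eq′)
              (limit (seq⟶ x o) _ x∋n)

      -- A proper descendant lies in a piece that the root avoids, and two paths to `u` start with
      -- the same child because the pieces are disjoint.
      Tree-functional : ∀ {A x u b c} → Tree A x u b → Tree A x u c → b ≡ c
      Tree-functional (root _) (root _) = refl
      Tree-functional (root _) (branch o n n∋A t) = ⊥-elim (∌-piece _ o n (branch-∋ o n n∋A t))
      Tree-functional (branch o n n∋A t) (root _) = ⊥-elim (∌-piece _ o n (branch-∋ o n n∋A t))
      Tree-functional (branch o n n∋A t) (branch o′ m m∋A t′)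
        with refl ← Uncoloured-irrelevant o o′
        with _ , refl , refl ← ∋-inhabited (∋-∩ (branch-∋ o n n∋A t) (branch-∋ o m m∋A t′))
        = cong not (Tree-functional t t′)

      -- Follow the path to `u` and append one more branch. `True` of `em` lowers `Tree` to `Set`,
      -- where `_∋_` takes its predicates.
      Tree-alternates : ∀ {A x u b} → x ∋ A → Tree A x u b → ∀ o →
                        p ∋ (λ n → True (em {P = Tree A x (seq u o n) (not b)}))
      Tree-alternates x∋A (root _) o =
        ∋-zip (λ n∋A n∉ → fromWitness (branch o _ n∋A (root n∉)))
              (limit (seq⟶ _ o) _ x∋A) (seq-uncoloured _ o)
      Tree-alternates x∋A (branch o n n∋A t) o′ =
        ∋-map (λ w → fromWitness (branch o n n∋A (toWitness w)))
              (Tree-alternates (∋-∩ n∋A (separated (seq⟶ _ o) n)) t o′)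

      -- Colouring the tree below an uncoloured `x` by parity would extend `M`; `limit-unique`
      -- passes from the chosen sequence to an arbitrary one.
      coloured : ∀ x → ∃ λ b → T (M (x , b))
      coloured x = dne λ ∄ → no-extension
        (λ u b → True (em {P = Tree U x u b}))
        (Tree-uncoloured ∘ toWitness)
        (λ t t′ → Tree-functional (toWitness t) (toWitness t′))
        (λ {_} {u} w f⟶u → let t = toWitness w ; o = Tree-uncoloured t in
          ∋-zip (λ f≡seq t′ → inj₂ (subst (λ y → True (em {P = Tree U x y _})) (sym f≡seq) t′))
                (limit-unique f⟶u (seq⟶ u o))
                (Tree-alternates (∋-always _) t o))
        x false (fromWitness (root λ b x∈ → ∄ (b , x∈)))

    total-colouring : ∃ λ M → Good M × ∀ x → ∃ λ b → T (M (x , b))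
    total-colouring with M , good , maximal ← maximal-good Good Good-⊔ =
      M , good , Maximal.coloured good maximal

  -- Copies of ω ∪ {p}

  -- The topology of X is generated by the sets ⟦ A ⟧, pulled back along π.
  record Generated (X : Space) (π : Space.Carrier X → Ultrafilter) : Set₂ where
    field
      ⟦⟧-open : ∀ A → Space.Open X (π ⊢ ⟦ A ⟧)
      nbhd    : ∀ {V} → Space.Open X V → ∀ {z} → z ∈ V →
                ∃ λ A → π z ∈ ⟦ A ⟧ × (∀ y → π y ∈ ⟦ A ⟧ → y ∈ V)

  open Generated

  βω-generated : Generated βω id
  ⟦⟧-open βω-generated A = (_≡ A) , (λ x → A , refl , x) , λ { (_ , refl , x) → x }
  nbhd βω-generated (F , V⊆ , ⊆V) z∈V with A , A∈F , A∈z ← V⊆ z∈V =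
    A , A∈z , λ y A∈y → ⊆V (A , A∈F , A∈y)

  Subspace-generated : ∀ {X π} S → Generated X π → Generated (Subspace X S) (π ∘ proj₁)
  ⟦⟧-open (Subspace-generated {π = π} S g) A = π ⊢ ⟦ A ⟧ , ⟦⟧-open g A , id , id
  nbhd (Subspace-generated S g) (W , oW , V⊆ , ⊆V) z∈V
    with A , A∈z , A⊆W ← nbhd g oW (V⊆ z∈V) = A , A∈z , λ (y , _) A∈y → ⊆V (A⊆W y A∈y)

  nonprincipal : ¬ p ∈ ω → ∀ n → ¬ p ∋ (_≡ n)
  nonprincipal {p} p∉ω n p∋n = p∉ω (n , λ A → T-injective
    (λ A∈p → case-∋ (∋-inhabited (∋-∩ p∋n (∋⁺ A A∈p))))
    (λ An → ∋⁻ A (∋-map (λ { refl → An }) p∋n)))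
    where
    case-∋ : ∀ {A} → ∃ ((_≡ n) ∩ (T ∘ A)) → T (A n)
    case-∋ (_ , refl , An) = An

  module Copy (p∈ω* : Space.Carrier ω*) {Y : Pred (Space.Carrier ω*) 0ℓ}
              (H : Homeomorphism (Subspace ω* Y) ω∪⟨ p∈ω* ⟩) where

    open Homeomorphism H
    open Inverse inverse using (from; strictlyInverseˡ)

    private
      q = proj₁ p∈ω*

      Y-generated : Generated (Subspace ω* Y) (proj₁ ∘ proj₁)
      Y-generated = Subspace-generated Y (Subspace-generated (∁ ω) βω-generated)

      ω∪q-generated : Generated ω∪⟨ p∈ω* ⟩ proj₁
      ω∪q-generated = Subspace-generated _ βω-generated

    isolated : ℕ → Space.Carrier ω∪⟨ p∈ω* ⟩
    isolated n = principal n , inj₁ (n , λ _ → refl)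

    nonisolated : Space.Carrier ω∪⟨ p∈ω* ⟩
    nonisolated = q , inj₂ λ _ → refl

    point : Space.Carrier ω∪⟨ p∈ω* ⟩ → Ultrafilter
    point z = proj₁ (proj₁ (from z))

    point∈Y : ∀ z → proj₁ (from z) ∈ Y
    point∈Y z = proj₂ (from z)

    -- The singleton of n is clopen in βω; its preimage in the copy contains a basic neighbourhood.
    isolating : ∀ n → ∃ λ A → point (isolated n) ∈ ⟦ A ⟧ ×
                      (∀ m → point (isolated m) ∈ ⟦ A ⟧ → m ≡ n)
    isolating n
      with A , A∈ , A⊆ ← nbhd Y-generated (to-continuous (⟦⟧-open ω∪q-generated (_≡ᵇ n)))
             (subst T (sym (strictlyInverseˡ (isolated n) (_≡ᵇ n))) (≡⇒≡ᵇ n n refl)) =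
      A , A∈ , λ m A∈m →
        ≡ᵇ⇒≡ m n (subst T (strictlyInverseˡ (isolated m) (_≡ᵇ n)) (A⊆ _ A∈m))

    converges : (point ∘ isolated) ⟶[ q ] point nonisolated
    converges = record
      { label     = proj₁ separation
      ; separated = proj₂ separation
      ; limit     = λ { P (holds x) →
          -- Continuity of `from` at `q`: for n in `A`, `principal n` lies in the neighbourhood
          -- `⟦ A ⟧`, so its image contains `P`.
          let A , A∈q , A⊆ = nbhd ω∪q-generated
                (from-continuous (⟦⟧-open Y-generated (λ n → ⟪ P n ⟫))) {nonisolated} x
          in ∋-map (holds ∘ A⊆ (isolated _)) (∋⁺ A A∈q) }
      }
      where
      separation = separate (λ n → T ∘ proj₁ (isolating n))
        (λ n → ∋⁺ _ (proj₁ (proj₂ (isolating n))))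
        (λ {m} {n} → proj₂ (proj₂ (isolating n)) m ∘ ∋⁻ _)

theorem5p13 : (∀ {ℓ} → ExcludedMiddle ℓ) →
    (∀ {a b} → Extensionality a b) →
    (p : Space.Carrier ω*) → ¬ (ω* ⟶⟨ ω∪⟨ p ⟩ ⟩¹₂)
theorem5p13 em ext p arrow =
  let M , good , coloured = total-colouring
      i , _ , _ , Y⊆ , H = arrow
        (λ i (x , _) → T (M (x , colour i)))
        (λ i x≈y → subst (λ x → T (M (x , colour i))) (mem-injective (ext x≈y)))
        (λ (x , _) → index (coloured x))
      open Copy p H
      -- Some isolated point has the colour opposite to that of the limit, although the copy is
      -- monochromatic.
      _ , opposite = ∋-inhabited
        (Good.alternates good (Y⊆ (point∈Y nonisolated)) converges)
  in not-¬ refl (Good.functional good (Y⊆ (point∈Y (isolated _))) opposite)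
  where
  open Classical em ext
  open Colouring (proj₁ p) (nonprincipal (proj₂ p))

  colour : Fin 2 → Bool
  colour zero    = false
  colour (suc _) = true

  index : ∀ {P : Bool → Set} → ∃ P → ∃ (P ∘ colour)
  index (false , x) = zero , x
  index (true  , x) = suc zero , x
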